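{- Let $n\ge 2$ and let $q$ be a prime power, and identify $E_q=\{0,1,\dots,q-1\}$ with the finite field $\mathbb{F}_q$, so that $E_q^n$ is an $n$-dimensional vector space over $\mathbb{F}_q$. Then every linear subspace $L\subseteq E_q^n$ with $|L|>1$ is metrically dense: $R(L)\le R(B)$ for every subset $B\subseteq E_q^n$ that is isometric to $L$.
   Context: $E_q^n$ carries the Hamming distance $d_H(x,y)=|\{i: x_i\neq y_i\}|$. For $A\subseteq E_q^n$, $R(A)$ is the number of coordinates $i$ such that the $i$-th coordinates of the elements of $A$ are not all equal (the number of non-constant columns of the matrix whose rows are the elements of $A$). Two subsets $A,B\subseteq E_q^n$ are isometric if there is a bijection $\phi:A\to B$ with $d_H(\phi(x),\phi(y))=d_H(x,y)$ for all $x,y\in A$. -}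

module Defs where

open import Algebra.Apartness.Structures using (IsHeytingField)
open import Data.Bool.Base using (Bool; T)
open import Data.Bool.Properties using (T?)
open import Data.Fin.Base using (Fin)
import Data.Fin.Properties as Fin
import Data.List.Base as List
import Data.List.Membership.Propositional as List
open import Data.List.Membership.Propositional.Properties
  using (∈-cartesianProductWith⁺; ∈-allFin)
import Data.List.Relation.Unary.All as All
open import Data.List.Relation.Unary.Any using (here)
open import Data.Nat.Base using (ℕ; zero; suc; _≤_; _^_)
open import Data.Nat.Primality using (Prime)
open import Data.Product.Base using (Σ; Σ-syntax; ∃₂; _×_; proj₁)
open import Data.Vec.Base
  using (Vec; []; _∷_; allFin; count; lookup; map; replicate; zipWith)
open import Function.Bundles using (_⤖_; module Bijection)
open import Relation.Binary.PropositionalEquality using (_≡_; _≢_; refl)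
open import Relation.Nullary.Decidable using (Dec; ¬?; _→-dec_; map′)
open import Relation.Unary using (Pred; Decidable)
open import Level using (0ℓ)

Word : ℕ → ℕ → Set
Word q n = Vec (Fin q) n

words : ∀ q n → List.List (Word q n)
words q zero    = List.[ [] ]
words q (suc n) = List.cartesianProductWith _∷_ (List.allFin q) (words q n)

∈-words : ∀ {q n} (x : Word q n) → x List.∈ words q n
∈-words []      = here refl
∈-words (a ∷ x) = ∈-cartesianProductWith⁺ _∷_ (∈-allFin a) (∈-words x)

allWords? : ∀ {q n} {P : Pred (Word q n) 0ℓ} → Decidable P → Dec (∀ x → P x)
allWords? P? =
  map′ (λ ps x → All.lookup ps (∈-words x)) (λ p → All.tabulate (λ {x} _ → p x))
       (All.all? P? (words _ _))

-- Subsets of the finite set Word q n are given by characteristic functions.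
Subset : ℕ → ℕ → Set
Subset q n = Word q n → Bool

module _ {q n : ℕ} where

  infix 4 _∈_

  _∈_ : Word q n → Subset q n → Set
  x ∈ A = T (A x)

  -- Membership proofs are unique, so _≡_ on Elem A is equality of words.
  Elem : Subset q n → Set
  Elem A = Σ[ x ∈ Word q n ] x ∈ A

  -- The list words q n has no repetitions.
  ∣_∣ : Subset q n → ℕ
  ∣ A ∣ = List.length (List.filterᵇ A (words q n))

  dH : Word q n → Word q n → ℕ
  dH x y = count (λ i → ¬? (lookup x i Fin.≟ lookup y i)) (allFin n)

  ConstantColumn : Subset q n → Fin n → Set
  ConstantColumn A i =
    ∀ x → x ∈ A → ∀ y → y ∈ A → lookup x i ≡ lookup y i

  constantColumn? : ∀ A → Decidable (ConstantColumn A)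
  constantColumn? A i =
    allWords? λ x → T? (A x) →-dec
    allWords? λ y → T? (A y) →-dec
    (lookup x i Fin.≟ lookup y i)

  R : Subset q n → ℕ
  R A = count (λ i → ¬? (constantColumn? A i)) (allFin n)

  Isometric : Subset q n → Subset q n → Set
  Isometric A B =
    Σ[ φ ∈ Elem A ⤖ Elem B ] ∀ x y →
      dH (proj₁ (Bijection.to φ x)) (proj₁ (Bijection.to φ y))
        ≡ dH (proj₁ x) (proj₁ y)

  MetricallyDense : Subset q n → Set
  MetricallyDense A = ∀ (B : Subset q n) → Isometric A B → R A ≤ R B

IsPrimePower : ℕ → Set
IsPrimePower q = ∃₂ λ p k → Prime p × 1 ≤ k × q ≡ p ^ k

-- A field with underlying set A. For the apartness _≢_ on a set with
-- decidable equality, a Heyting field is a field in the classical sense: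
-- x - y is invertible exactly when x ≢ y (so in particular 0# ≢ 1#).
record FieldOn (A : Set) : Set where
  infixl 7 _*_
  infixl 6 _+_
  infix  8 -_
  field
    _+_ _*_        : A → A → A
    -_             : A → A
    0# 1#          : A
    isHeytingField : IsHeytingField _≡_ _≢_ _+_ _*_ -_ 0# 1#

record IsLinearSubspace {q n} (F : FieldOn (Fin q)) (L : Subset q n) : Set where
  open FieldOn F
  field
    0-closed : replicate n 0# ∈ L
    +-closed : ∀ {x y} → x ∈ L → y ∈ L → zipWith _+_ x y ∈ L
    *-closed : ∀ a {x} → x ∈ L → map (a *_) x ∈ L

{-# OPTIONS --safe #-}

-- Double counting of the distances between all ordered pairs of elements of L.
-- Let M = |L|. For any map f from L to an alphabet of q letters, with fibres of
-- sizes c_a, the number of pairs with f x = f y is Σ c_a² ≥ M²/q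
-- (Cauchy–Schwarz), so a single column separates at most M² - M²/q pairs.
-- A nonconstant column of a linear subspace attains this bound: it takes every
-- value, and translations of L show that all its fibres have the same size.
-- An isometry preserves the total distance, which is therefore equal to
-- R(L) (M² - M²/q) and at most R(B) (M² - M²/q).
module Submission where

open import Algebra.Apartness.Bundles using (HeytingCommutativeRing)
import Algebra.Apartness.Properties.HeytingCommutativeRing as HeytingProperties
open import Algebra.Apartness.Structures using (IsHeytingField)
open import Algebra.Bundles using (CommutativeRing)
import Algebra.Properties.Ring as RingProperties
open import Data.Bool.Base using (if_then_else_; true; false)
open import Data.Bool.Properties using (T?; T-irrelevant)
open import Data.Fin.Base using (Fin; zero; suc)
import Data.Fin.Properties as Fin
open import Data.List.Base using (List; []; _∷_; length; allFin; mapMaybe; deduplicate)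
import Data.List.Membership.Propositional as List
open import Data.List.Membership.Propositional.Properties
  using (∈-allFin; ∈-deduplicate⁺)
open import Data.List.Properties using (length-tabulate)
open import Data.List.Relation.Unary.All as All using (All; []; _∷_)
open import Data.List.Relation.Unary.All.Properties using (¬All⇒Any¬)
open import Data.List.Relation.Unary.Any as Any using (here; there)
open import Data.List.Relation.Unary.AllPairs using (_∷_)
open import Data.List.Relation.Unary.Unique.Propositional using (Unique)
open import Data.List.Relation.Unary.Unique.Propositional.Properties using (allFin⁺)
open import Data.List.Relation.Unary.Unique.DecPropositional.Properties using (deduplicate-!)
open import Data.Maybe.Base using (Maybe; just; nothing)
open import Data.Nat.Base
open import Data.Nat.Properties hiding (_≟_)
open import Data.Nat.Tactic.RingSolver using (solve-∀)
open import Algebra.Properties.CommutativeSemigroup +-commutativeSemigroup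
  using () renaming (interchange to +-interchange)
open import Data.Product.Base using (∃; _,_; proj₁; proj₂)
import Data.Product.Properties as Product
open import Data.Vec.Base as Vec using (Vec; []; _∷_; lookup; zipWith; toList; count)
import Data.Vec.Properties as Vec
open import Function.Base using (_∘_; id)
open import Function.Bundles using (mk⇔; module Bijection)
open import Relation.Binary.Definitions using (DecidableEquality)
open import Relation.Binary.PropositionalEquality
open import Relation.Nullary using (¬_; contradiction)
open import Relation.Nullary.Decidable using (Dec; yes; no; does; ¬?; does-⇔)
open import Relation.Unary using (Decidable)

open import Defs

private
  variable
    A B P Q : Set

-- Indicators of decidable propositions.

⟦_⟧ : Dec P → ℕ
⟦ P? ⟧ = if does P? then 1 else 0

⟦⟧-cong : (P → Q) → (Q → P) → (P? : Dec P) (Q? : Dec Q) → ⟦ P? ⟧ ≡ ⟦ Q? ⟧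
⟦⟧-cong f g P? Q? = cong (if_then 1 else 0) (does-⇔ (mk⇔ f g) P? Q?)

⟦⟧-yes : (P? : Dec P) → P → ⟦ P? ⟧ ≡ 1
⟦⟧-yes (yes _) _ = refl
⟦⟧-yes (no ¬p) p = contradiction p ¬p

⟦⟧-no : (P? : Dec P) → ¬ P → ⟦ P? ⟧ ≡ 0
⟦⟧-no (yes p) ¬p = contradiction p ¬p
⟦⟧-no (no _)  _  = refl

⟦⟧-compl : (P? : Dec P) → ⟦ ¬? P? ⟧ + ⟦ P? ⟧ ≡ 1
⟦⟧-compl (yes _) = refl
⟦⟧-compl (no _)  = refl

-- Sums over lists

∑ : List A → (A → ℕ) → ℕ
∑ []       f = 0
∑ (x ∷ xs) f = f x + ∑ xs f

∑-cong : ∀ (xs : List A) {f g} → (∀ x → f x ≡ g x) → ∑ xs f ≡ ∑ xs g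
∑-cong []       e = refl
∑-cong (x ∷ xs) e = cong₂ _+_ (e x) (∑-cong xs e)

∑-mono : ∀ (xs : List A) {f g} → (∀ x → f x ≤ g x) → ∑ xs f ≤ ∑ xs g
∑-mono []       e = z≤n
∑-mono (x ∷ xs) e = +-mono-≤ (e x) (∑-mono xs e)

∑-+ : ∀ (xs : List A) f g → ∑ xs (λ x → f x + g x) ≡ ∑ xs f + ∑ xs g
∑-+ []       f g = refl
∑-+ (x ∷ xs) f g = trans (cong (f x + g x +_) (∑-+ xs f g))
                         (+-interchange (f x) (g x) (∑ xs f) (∑ xs g))

∑-*ˡ : ∀ (xs : List A) c f → ∑ xs (λ x → c * f x) ≡ c * ∑ xs f
∑-*ˡ []       c f = sym (*-zeroʳ c)
∑-*ˡ (x ∷ xs) c f = trans (cong (c * f x +_) (∑-*ˡ xs c f))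
                          (sym (*-distribˡ-+ c (f x) (∑ xs f)))

∑-const : ∀ (xs : List A) c → ∑ xs (λ _ → c) ≡ length xs * c
∑-const []       c = refl
∑-const (x ∷ xs) c = cong (c +_) (∑-const xs c)

∑-comm : ∀ (xs : List A) (ys : List B) (f : A → B → ℕ) →
         ∑ xs (λ x → ∑ ys (f x)) ≡ ∑ ys (λ y → ∑ xs (λ x → f x y))
∑-comm []       ys f = sym (trans (∑-const ys 0) (*-zeroʳ (length ys)))
∑-comm (x ∷ xs) ys f = trans (cong (∑ ys (f x) +_) (∑-comm xs ys f))
                             (sym (∑-+ ys (f x) _))

-- `dH` and `R` are defined by `count`; once written as sums of indicators, they can be exchanged
-- with other sums.
count-toList : ∀ {P : A → Set} (P? : Decidable P) {n} (v : Vec A n) →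
               count P? v ≡ ∑ (toList v) (λ x → ⟦ P? x ⟧)
count-toList P? []      = refl
count-toList P? (x ∷ v) with does (P? x)
... | true  = cong suc (count-toList P? v)
... | false = count-toList P? v

-- Summation over types enumerated without repetition.

record Enumeration (A : Set) : Set where
  field
    elements : List A
    unique   : Unique elements
    complete : ∀ x → x List.∈ elements
    _≟_      : DecidableEquality A

  size : ℕ
  size = length elements

  ∑-pick-none : ∀ {b xs} (h : A → ℕ) → All (b ≢_) xs →
                ∑ xs (λ a → ⟦ b ≟ a ⟧ * h a) ≡ 0
  ∑-pick-none h []         = refl
  ∑-pick-none h (b≢x ∷ ps) =
    cong₂ _+_ (cong (_* h _) (⟦⟧-no (_ ≟ _) b≢x)) (∑-pick-none h ps)

  ∑-pick-∈ : ∀ {b xs} (h : A → ℕ) → Unique xs → b List.∈ xs →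
             ∑ xs (λ a → ⟦ b ≟ a ⟧ * h a) ≡ h b
  ∑-pick-∈ {b} h (b∉xs ∷ _) (here refl) =
    trans (cong₂ _+_ (cong (_* h b) (⟦⟧-yes (b ≟ b) refl)) (∑-pick-none h b∉xs))
          (trans (+-identityʳ (1 * h b)) (*-identityˡ (h b)))
  ∑-pick-∈ h (x∉xs ∷ u) (there b∈xs) =
    cong₂ _+_ (cong (_* h _) (⟦⟧-no (_ ≟ _) λ b≡x → All.lookup x∉xs b∈xs (sym b≡x)))
              (∑-pick-∈ h u b∈xs)

  -- The indicator acts as a Kronecker delta: completeness supplies the term at `b`, and uniqueness
  -- makes it the only nonvanishing factor.
  ∑-pick : ∀ b (h : A → ℕ) → ∑ elements (λ a → ⟦ b ≟ a ⟧ * h a) ≡ h b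
  ∑-pick b h = ∑-pick-∈ h unique (complete b)

  ∑-⟦≟⟧ : ∀ b → ∑ elements (λ a → ⟦ b ≟ a ⟧) ≡ 1
  ∑-⟦≟⟧ b = trans (∑-cong elements λ a → sym (*-identityʳ ⟦ b ≟ a ⟧))
                  (∑-pick b (λ _ → 1))

  -- Each `h (τ x)` is expanded by `∑-pick` into a sum over `y`. After the sums are exchanged,
  -- `τ x ≡ y` becomes `σ y ≡ x`, which holds for exactly one `x`.
  ∑-reindex : ∀ (τ σ : A → A) → (∀ x → σ (τ x) ≡ x) → (∀ y → τ (σ y) ≡ y) →
              ∀ h → ∑ elements (h ∘ τ) ≡ ∑ elements h
  ∑-reindex τ σ στ τσ h = begin
    ∑ elements (λ x → h (τ x))
      ≡⟨ ∑-cong elements (λ x → ∑-pick (τ x) h) ⟨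
    ∑ elements (λ x → ∑ elements (λ y → ⟦ τ x ≟ y ⟧ * h y))
      ≡⟨ ∑-comm elements elements _ ⟩
    ∑ elements (λ y → ∑ elements (λ x → ⟦ τ x ≟ y ⟧ * h y))
      ≡⟨ ∑-cong elements (λ y → ∑-cong elements (λ x → trans
           (cong (_* h y) (⟦⟧-cong (λ e → trans (cong σ (sym e)) (στ x))
                                   (λ e → trans (cong τ (sym e)) (τσ y))
                                   (τ x ≟ y) (σ y ≟ x)))
           (*-comm ⟦ σ y ≟ x ⟧ (h y)))) ⟩
    ∑ elements (λ y → ∑ elements (λ x → h y * ⟦ σ y ≟ x ⟧))
      ≡⟨ ∑-cong elements (λ y → ∑-*ˡ elements (h y) _) ⟩
    ∑ elements (λ y → h y * ∑ elements (λ x → ⟦ σ y ≟ x ⟧))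
      ≡⟨ ∑-cong elements (λ y → trans (cong (h y *_) (∑-⟦≟⟧ (σ y))) (*-identityʳ (h y))) ⟩
    ∑ elements h ∎
    where open ≡-Reasoning

finEnumeration : ∀ q → Enumeration (Fin q)
finEnumeration q = record
  { elements = allFin q
  ; unique   = allFin⁺ q
  ; complete = ∈-allFin
  ; _≟_      = Fin._≟_
  }

-- Cauchy–Schwarz

2mn≤m²+n² : ∀ m n → m * n + m * n ≤ m * m + n * n
2mn≤m²+n² zero    n       = z≤n
2mn≤m²+n² (suc m) zero    rewrite *-zeroʳ m = z≤n
2mn≤m²+n² (suc m) (suc n) = begin
  suc m * suc n + suc m * suc n           ≡⟨ cong₂ _+_ (expand m n) (expand m n) ⟩
  (m * n + (m + n + 1)) + (m * n + (m + n + 1))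
    ≡⟨ +-interchange (m * n) _ (m * n) _ ⟩
  (m * n + m * n) + ((m + n + 1) + (m + n + 1))
    -- Passing from `m` and `n` to their successors adds `2 * (m + n + 1)` to both sides, so the
    -- inequality comes from the induction hypothesis alone.
    ≤⟨ +-mono-≤ (2mn≤m²+n² m n) (≤-reflexive (regroup m n)) ⟩
  (m * m + n * n) + ((m + m + 1) + (n + n + 1))
    ≡⟨ +-interchange (m * m) (n * n) _ _ ⟩
  (m * m + (m + m + 1)) + (n * n + (n + n + 1))
    ≡⟨ cong₂ _+_ (expand m m) (expand n n) ⟨
  suc m * suc m + suc n * suc n           ∎
  where
  open ≤-Reasoning
  expand : ∀ a b → suc a * suc b ≡ a * b + (a + b + 1)
  expand = solve-∀
  regroup : ∀ a b → (a + b + 1) + (a + b + 1) ≡ (a + a + 1) + (b + b + 1)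
  regroup = solve-∀

-- The inequality `2mn≤m²+n²` is summed over all ordered pairs of entries. On the right each square
-- then occurs `2 * length xs` times, and the factor 2 cancels.
∑²≤length*∑² : ∀ (xs : List A) c → ∑ xs c * ∑ xs c ≤ length xs * ∑ xs (λ a → c a * c a)
∑²≤length*∑² xs c = *-cancelˡ-≤ 2 (begin
  2 * (S * S)                           ≡⟨ cong (S * S +_) (+-identityʳ (S * S)) ⟩
  S * S + S * S                         ≡⟨ cong₂ _+_ S² S² ⟩
  ∑ xs (λ a → ∑ xs (λ b → c a * c b)) + ∑ xs (λ a → ∑ xs (λ b → c a * c b))
    ≡⟨ ∑∑-+ _ _ ⟨
  ∑ xs (λ a → ∑ xs (λ b → c a * c b + c a * c b))
    ≤⟨ ∑-mono xs (λ a → ∑-mono xs (λ b → 2mn≤m²+n² (c a) (c b))) ⟩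
  ∑ xs (λ a → ∑ xs (λ b → c a * c a + c b * c b))
    ≡⟨ ∑∑-+ _ _ ⟩
  ∑ xs (λ a → ∑ xs (λ b → c a * c a)) + ∑ xs (λ a → ∑ xs (λ b → c b * c b))
    ≡⟨ cong₂ _+_ (trans (∑-comm xs xs _) (∑-const xs _)) (∑-const xs _) ⟩
  length xs * D + length xs * D
    ≡⟨ cong (length xs * D +_) (+-identityʳ (length xs * D)) ⟨
  2 * (length xs * D)                   ∎)
  where
  open ≤-Reasoning
  S = ∑ xs c
  D = ∑ xs (λ a → c a * c a)
  S² : S * S ≡ ∑ xs (λ a → ∑ xs (λ b → c a * c b))
  S² = trans (sym (∑-*ˡ xs S c)) (∑-cong xs λ a →
       trans (*-comm S (c a)) (sym (∑-*ˡ xs (c a) c)))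
  ∑∑-+ : ∀ (f g : _ → _ → ℕ) → ∑ xs (λ a → ∑ xs (λ b → f a b + g a b))
         ≡ ∑ xs (λ a → ∑ xs (f a)) + ∑ xs (λ a → ∑ xs (g a))
  ∑∑-+ f g = trans (∑-cong xs λ a → ∑-+ xs (f a) (g a)) (∑-+ xs _ _)

-- Pairs of indices on which a column agrees or differs

module Column {X : Set} (xs : List X) {q : ℕ} (f : X → Fin q) where

  fibre : Fin q → ℕ
  fibre a = ∑ xs (λ x → ⟦ f x Fin.≟ a ⟧)

  agreeing differing : ℕ
  agreeing  = ∑ xs (λ x → ∑ xs (λ y → ⟦ f x Fin.≟ f y ⟧))
  differing = ∑ xs (λ x → ∑ xs (λ y → ⟦ ¬? (f x Fin.≟ f y) ⟧))

  private
    module F = Enumeration (finEnumeration q)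
    M = length xs

  length-letters : F.size ≡ q
  length-letters = length-tabulate id

  differing+agreeing : differing + agreeing ≡ M * M
  differing+agreeing = begin
    differing + agreeing              ≡⟨ ∑-+ xs _ _ ⟨
    ∑ xs (λ x → ∑ xs _ + ∑ xs _)      ≡⟨ ∑-cong xs (λ x → sym (∑-+ xs _ _)) ⟩
    ∑ xs (λ x → ∑ xs (λ y → ⟦ ¬? (f x Fin.≟ f y) ⟧ + ⟦ f x Fin.≟ f y ⟧))
      ≡⟨ ∑-cong xs (λ x → ∑-cong xs (λ y → ⟦⟧-compl (f x Fin.≟ f y))) ⟩
    ∑ xs (λ x → ∑ xs (λ y → 1))       ≡⟨ ∑-cong xs (λ x → trans (∑-const xs 1) (*-identityʳ M)) ⟩
    ∑ xs (λ x → M)                    ≡⟨ ∑-const xs M ⟩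
    M * M                             ∎
    where open ≡-Reasoning

  -- With the second index of the pair held fixed at `y`, the inner sum is `fibre (f y)` by
  -- definition.
  agreeing≡∑fibre : agreeing ≡ ∑ xs (λ x → fibre (f x))
  agreeing≡∑fibre = ∑-comm xs xs _

  ∑fibre : ∑ F.elements fibre ≡ M
  ∑fibre = begin
    ∑ F.elements fibre                                   ≡⟨ ∑-comm F.elements xs _ ⟩
    ∑ xs (λ x → ∑ F.elements (λ a → ⟦ f x Fin.≟ a ⟧))    ≡⟨ ∑-cong xs (λ x → F.∑-⟦≟⟧ (f x)) ⟩
    ∑ xs (λ x → 1)                                       ≡⟨ ∑-const xs 1 ⟩
    M * 1                                                ≡⟨ *-identityʳ M ⟩
    M                                                    ∎
    where open ≡-Reasoning

  -- Agreeing pairs are grouped by their common letter; a letter `a` accounts for all pairs within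
  -- its fibre.
  ∑fibre² : ∑ F.elements (λ a → fibre a * fibre a) ≡ agreeing
  ∑fibre² = begin
    ∑ F.elements (λ a → fibre a * fibre a)
      ≡⟨ ∑-cong F.elements (λ a → ∑-*ˡ xs (fibre a) _) ⟨
    ∑ F.elements (λ a → ∑ xs (λ x → fibre a * ⟦ f x Fin.≟ a ⟧))
      ≡⟨ ∑-comm F.elements xs _ ⟩
    ∑ xs (λ x → ∑ F.elements (λ a → fibre a * ⟦ f x Fin.≟ a ⟧))
      ≡⟨ ∑-cong xs (λ x → trans (∑-cong F.elements λ a → *-comm (fibre a) _)
                                (F.∑-pick (f x) fibre)) ⟩
    ∑ xs (λ x → fibre (f x))
      ≡⟨ agreeing≡∑fibre ⟨
    agreeing ∎
    where open ≡-Reasoning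

  -- Cauchy-Schwarz for the `q` fibre sizes, whose sum is `M`.
  M²≤q*agreeing : M * M ≤ q * agreeing
  M²≤q*agreeing = begin
    M * M                                   ≡⟨ cong₂ _*_ ∑fibre ∑fibre ⟨
    ∑ F.elements fibre * ∑ F.elements fibre ≤⟨ ∑²≤length*∑² F.elements fibre ⟩
    F.size * _                              ≡⟨ cong₂ _*_ length-letters ∑fibre² ⟩
    q * agreeing                            ∎
    where open ≤-Reasoning

  -- The factor `q` clears the denominator in M² - M²/q. Truncated subtraction is exact here, since
  -- `q * agreeing` is a summand of `q * (M * M)`.
  q*differing : q * differing ≡ q * (M * M) ∸ q * agreeing
  q*differing = begin
    q * differing                                 ≡⟨ m+n∸n≡m (q * differing) (q * agreeing) ⟨
    q * differing + q * agreeing ∸ q * agreeing   ≡⟨ cong (_∸ q * agreeing) (*-distribˡ-+ q differing agreeing) ⟨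
    q * (differing + agreeing) ∸ q * agreeing     ≡⟨ cong (λ z → q * z ∸ q * agreeing) differing+agreeing ⟩
    q * (M * M) ∸ q * agreeing                    ∎
    where open ≡-Reasoning

  q*differing≤ : q * differing ≤ q * (M * M) ∸ M * M
  q*differing≤ = ≤-trans (≤-reflexive q*differing) (∸-monoʳ-≤ (q * (M * M)) M²≤q*agreeing)

  differing-constant : (∀ x y → f x ≡ f y) → differing ≡ 0
  differing-constant e = begin
    differing                    ≡⟨ ∑-cong xs (λ x → ∑-cong xs (λ y → ⟦⟧-no (¬? (f x Fin.≟ f y)) (λ ne → ne (e x y)))) ⟩
    ∑ xs (λ x → ∑ xs (λ y → 0))  ≡⟨ ∑-cong xs (λ x → trans (∑-const xs 0) (*-zeroʳ M)) ⟩
    ∑ xs (λ x → 0)               ≡⟨ trans (∑-const xs 0) (*-zeroʳ M) ⟩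
    0                            ∎
    where open ≡-Reasoning

  -- The equality case of Cauchy-Schwarz: every index agrees with exactly M/q indices.
  q*differing-equidistributed : (∀ a → q * fibre a ≡ M) → q * differing ≡ q * (M * M) ∸ M * M
  q*differing-equidistributed e = trans q*differing (cong (q * (M * M) ∸_) (begin
    q * agreeing                   ≡⟨ cong (q *_) agreeing≡∑fibre ⟩
    q * ∑ xs (λ x → fibre (f x))   ≡⟨ ∑-*ˡ xs q _ ⟨
    ∑ xs (λ x → q * fibre (f x))   ≡⟨ ∑-cong xs (λ x → e (f x)) ⟩
    ∑ xs (λ x → M)                 ≡⟨ ∑-const xs M ⟩
    M * M                          ∎))
    where open ≡-Reasoning

-- Elements and coordinates of a subset

indices : ∀ n → List (Fin n)
indices n = toList (Vec.allFin n)

module _ {q n : ℕ} where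

  elem≡ : ∀ {S : Subset q n} {x y : Elem S} → proj₁ x ≡ proj₁ y → x ≡ y
  elem≡ {x = x , p} {y = .x , p′} refl = cong (x ,_) (T-irrelevant p p′)

  -- The list `words q n` is filtered with membership proofs attached: completeness comes from
  -- `∈-words`, and uniqueness from `deduplicate`.
  elemEnumeration : (S : Subset q n) → Enumeration (Elem S)
  elemEnumeration S = record
    { elements = deduplicate _≟ₑ_ candidates
    ; unique   = deduplicate-! _≟ₑ_ candidates
    ; complete = λ { (x , p) → ∈-deduplicate⁺ _≟ₑ_ (∈-candidates p (∈-words x)) }
    ; _≟_      = _≟ₑ_
    }
    where
    _≟ₑ_ : DecidableEquality (Elem S)
    _≟ₑ_ = Product.≡-dec (Vec.≡-dec Fin._≟_) (λ p p′ → yes (T-irrelevant p p′))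

    elem? : Word q n → Maybe (Elem S)
    elem? x with T? (S x)
    ... | yes p = just (x , p)
    ... | no _  = nothing

    candidates : List (Elem S)
    candidates = mapMaybe elem? (words q n)

    ∈-candidates : ∀ {x xs} (p : x ∈ S) → x List.∈ xs → (x , p) List.∈ mapMaybe elem? xs
    ∈-candidates {x} p (here refl) with T? (S x)
    ... | yes p′ = here (elem≡ refl)
    ... | no ¬p  = contradiction p ¬p
    ∈-candidates p (there {x = y} x∈xs) with T? (S y)
    ... | yes _ = there (∈-candidates p x∈xs)
    ... | no _  = ∈-candidates p x∈xs

  -- Distances are summed column by column. The words are indexed by a map `w`, so that the elements
  -- of a subspace can index both its own words and those of an isometric image.
  ∑-dH : ∀ {X : Set} (xs : List X) (w : X → Word q n) →
         ∑ xs (λ x → ∑ xs (λ y → dH (w x) (w y)))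
         ≡ ∑ (indices n) (λ i → Column.differing xs (λ x → lookup (w x) i))
  ∑-dH xs w = begin
    ∑ xs (λ x → ∑ xs (λ y → dH (w x) (w y)))
      ≡⟨ ∑-cong xs (λ x → ∑-cong xs (λ y → count-toList _ (Vec.allFin n))) ⟩
    ∑ xs (λ x → ∑ xs (λ y → ∑ (indices n) (λ i → ⟦ ¬? (lookup (w x) i Fin.≟ lookup (w y) i) ⟧)))
      ≡⟨ ∑-cong xs (λ x → ∑-comm xs (indices n) _) ⟩
    ∑ xs (λ x → ∑ (indices n) (λ i → ∑ xs (λ y → ⟦ ¬? (lookup (w x) i Fin.≟ lookup (w y) i) ⟧)))
      ≡⟨ ∑-comm xs (indices n) _ ⟩
    ∑ (indices n) (λ i → Column.differing xs (λ x → lookup (w x) i)) ∎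
    where open ≡-Reasoning

  ∑-nonconstant : ∀ (S : Subset q n) c → ∑ (indices n) (λ i → c * ⟦ ¬? (constantColumn? S i) ⟧) ≡ c * R S
  ∑-nonconstant S c = trans (∑-*ˡ (indices n) c _)
    (cong (c *_) (sym (count-toList (λ i → ¬? (constantColumn? S i)) (Vec.allFin n))))

-- Columns of a linear subspace

module Subspace {q n : ℕ} (F : FieldOn (Fin q)) (L : Subset q n)
                (isSubspace : IsLinearSubspace F L) where

  open FieldOn F renaming (_+_ to _⊕_; _*_ to _⊗_; -_ to ⊖_)
  open IsHeytingField isHeytingField
    using (isHeytingCommutativeRing; #⇒invertible)
    renaming (+-assoc to ⊕-assoc; +-comm to ⊕-comm; +-identityʳ to ⊕-identityʳ;
              -‿inverseʳ to ⊖-inverseʳ; -‿inverseˡ to ⊖-inverseˡ;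
              *-assoc to ⊗-assoc; *-identityʳ to ⊗-identityʳ)
  open IsLinearSubspace isSubspace

  heytingCommutativeRing : HeytingCommutativeRing _ _ _
  heytingCommutativeRing = record { isHeytingCommutativeRing = isHeytingCommutativeRing }

  open HeytingProperties heytingCommutativeRing using (1#0; x-0≈x)
  open HeytingCommutativeRing heytingCommutativeRing using (commutativeRing)
  open RingProperties (CommutativeRing.ring commutativeRing) using (-1*x≈-x)

  open Enumeration (elemEnumeration L) public

  2≤q : 2 ≤ q
  2≤q = two 1# 0# 1#0
    where
    two : ∀ {q} (a b : Fin q) → a ≢ b → 2 ≤ q
    two {suc zero}    zero zero a≢b = contradiction refl a≢b
    two {suc (suc q)} _    _    _   = s≤s (s≤s z≤n)

  1≤size : 1 ≤ size
  1≤size with elements | complete (_ , 0-closed)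
  ... | _ ∷ _ | _ = s≤s z≤n

  column : Fin n → Elem L → Fin q
  column i x = lookup (proj₁ x) i

  -- The inverse is taken as the multiple by -1, which puts it in `L` by closure under scalars.
  neg : Elem L → Elem L
  neg (v , p) = Vec.map ((⊖ 1#) ⊗_) v , *-closed (⊖ 1#) p

  translate : Elem L → Elem L → Elem L
  translate (v , p) (x , p′) = zipWith _⊕_ x v , +-closed p′ p

  cancel-neg : ∀ v x → translate (neg v) (translate v x) ≡ x
  cancel-neg (v , _) (x , _) = elem≡ (go v x)
    where
    go : ∀ {m} (v x : Vec (Fin q) m) →
         zipWith _⊕_ (zipWith _⊕_ x v) (Vec.map ((⊖ 1#) ⊗_) v) ≡ x
    go []      []      = refl
    go (a ∷ v) (b ∷ x) = cong₂ _∷_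
      (trans (⊕-assoc b a _) (trans (cong (b ⊕_) (trans (cong (a ⊕_) (-1*x≈-x a)) (⊖-inverseʳ a)))
                                    (⊕-identityʳ b)))
      (go v x)

  neg-cancel : ∀ v x → translate v (translate (neg v) x) ≡ x
  neg-cancel (v , _) (x , _) = elem≡ (go v x)
    where
    go : ∀ {m} (v x : Vec (Fin q) m) →
         zipWith _⊕_ (zipWith _⊕_ x (Vec.map ((⊖ 1#) ⊗_) v)) v ≡ x
    go []      []      = refl
    go (a ∷ v) (b ∷ x) = cong₂ _∷_
      (trans (⊕-assoc b _ a) (trans (cong (b ⊕_) (trans (cong (_⊕ a) (-1*x≈-x a)) (⊖-inverseˡ a)))
                                    (⊕-identityʳ b)))
      (go v x)

  -- Some `u` in `L` has a nonzero entry at `i`, since a column of zeros would be constant. Scaling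
  -- `u` by `a` times the inverse of that entry gives `v`.
  column-surjective : ∀ i → ¬ ConstantColumn L i → ∀ a → ∃ λ v → column i v ≡ a
  column-surjective i ¬const a with All.all? (λ x → column i x Fin.≟ 0#) elements
  ... | yes zeros = contradiction (λ x p y p′ → trans (zero-at (x , p)) (sym (zero-at (y , p′)))) ¬const
    where
    zero-at : ∀ x → column i x ≡ 0#
    zero-at x = All.lookup zeros (complete x)
  ... | no ¬zeros with Any.satisfied (¬All⇒Any¬ (λ x → column i x Fin.≟ 0#) elements ¬zeros)
  ...   | (u , p) , u≢0 with #⇒invertible u≢0
  ...     | u⁻¹ , inverseˡ , _ = (Vec.map ((a ⊗ u⁻¹) ⊗_) u , *-closed (a ⊗ u⁻¹) p) , (begin
    lookup (Vec.map ((a ⊗ u⁻¹) ⊗_) u) i   ≡⟨ Vec.lookup-map i _ u ⟩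
    (a ⊗ u⁻¹) ⊗ lookup u i                ≡⟨ ⊗-assoc a u⁻¹ _ ⟩
    -- A Heyting field inverts differences of distinct elements, so `u⁻¹` is given as the inverse of
    -- the entry minus `0#`.
    a ⊗ (u⁻¹ ⊗ lookup u i)                ≡⟨ cong (λ z → a ⊗ (u⁻¹ ⊗ z)) (x-0≈x (lookup u i)) ⟨
    a ⊗ (u⁻¹ ⊗ (lookup u i ⊕ (⊖ 0#)))     ≡⟨ cong (a ⊗_) inverseˡ ⟩
    a ⊗ 1#                                ≡⟨ ⊗-identityʳ a ⟩
    a                                     ∎)
    where open ≡-Reasoning

  -- Equidistribution of a nonconstant column.

  module _ (i : Fin n) (¬const : ¬ ConstantColumn L i) where

    open Column elements (column i)

    private
      module Letters = Enumeration (finEnumeration q)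

    -- Translation by an element with entry `a` at `i` permutes `L` and turns the condition that the
    -- entry of `x` be `b` into one solved for `a`. In this form the sum over all letters `a` is
    -- immediate.
    fibre-shift : ∀ a b → fibre b ≡ ∑ elements (λ x → ⟦ b ⊕ (⊖ column i x) Fin.≟ a ⟧)
    fibre-shift a b with v , vᵢ≡a ← column-surjective i ¬const a = begin
      fibre b
        ≡⟨ ∑-reindex (translate v) (translate (neg v)) (cancel-neg v) (neg-cancel v) (λ x → ⟦ column i x Fin.≟ b ⟧) ⟨
      ∑ elements (λ x → ⟦ column i (translate v x) Fin.≟ b ⟧)
        ≡⟨ ∑-cong elements (λ x → ⟦⟧-cong
             (λ e → forward (column i x) (trans (sym (shift x)) e))
             (λ e → trans (shift x) (backward (column i x) e)) (_ Fin.≟ _) (_ Fin.≟ _)) ⟩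
      ∑ elements (λ x → ⟦ b ⊕ (⊖ column i x) Fin.≟ a ⟧) ∎
      where
      open ≡-Reasoning
      shift : ∀ x → column i (translate v x) ≡ column i x ⊕ a
      shift x = trans (Vec.lookup-zipWith _⊕_ i (proj₁ x) (proj₁ v)) (cong (column i x ⊕_) vᵢ≡a)
      forward : ∀ c → c ⊕ a ≡ b → b ⊕ (⊖ c) ≡ a
      forward c refl = trans (cong (_⊕ (⊖ c)) (⊕-comm c a))
        (trans (⊕-assoc a c (⊖ c)) (trans (cong (a ⊕_) (⊖-inverseʳ c)) (⊕-identityʳ a)))
      backward : ∀ c → b ⊕ (⊖ c) ≡ a → c ⊕ a ≡ b
      backward c refl = trans (⊕-comm c (b ⊕ (⊖ c)))
        (trans (⊕-assoc b (⊖ c) c) (trans (cong (b ⊕_) (⊖-inverseˡ c)) (⊕-identityʳ b)))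

    -- `fibre-shift` is summed over the `q` letters `a`; each `x` is then counted once, at `a` equal
    -- to `b` minus its entry.
    q*fibre≡size : ∀ b → q * fibre b ≡ size
    q*fibre≡size b = begin
      q * fibre b
        ≡⟨ cong (_* fibre b) length-letters ⟨
      Letters.size * fibre b
        ≡⟨ ∑-const Letters.elements (fibre b) ⟨
      ∑ Letters.elements (λ a → fibre b)
        ≡⟨ ∑-cong Letters.elements (λ a → fibre-shift a b) ⟩
      ∑ Letters.elements (λ a → ∑ elements (λ x → ⟦ b ⊕ (⊖ column i x) Fin.≟ a ⟧))
        ≡⟨ ∑-comm Letters.elements elements _ ⟩
      ∑ elements (λ x → ∑ Letters.elements (λ a → ⟦ b ⊕ (⊖ column i x) Fin.≟ a ⟧))
        ≡⟨ ∑-cong elements (λ x → Letters.∑-⟦≟⟧ (b ⊕ (⊖ column i x))) ⟩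
      ∑ elements (λ x → 1)
        ≡⟨ ∑-const elements 1 ⟩
      size * 1
        ≡⟨ *-identityʳ size ⟩
      size ∎
      where open ≡-Reasoning

  -- Comparison of total distances.

  maxDiffering : ℕ
  maxDiffering = q * (size * size) ∸ size * size

  -- `maxDiffering` is `q` times M² - M²/q. It is positive because `0#` and `1#` give two letters
  -- and `L` contains the zero word; this allows it to be cancelled at the end.
  maxDiffering>0 : NonZero maxDiffering
  maxDiffering>0 = >-nonZero (m<n⇒0<n∸m (begin-strict
    size * size        <⟨ m<m*n (size * size) q 2≤q ⟩
    size * size * q    ≡⟨ *-comm (size * size) q ⟩
    q * (size * size)  ∎))
    where
    open ≤-Reasoning
    instance
      M²≢0 : NonZero (size * size)
      M²≢0 = >-nonZero (*-mono-≤ 1≤size 1≤size)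

  -- Equidistribution makes a nonconstant column attain the bound. The decision is an argument so
  -- that matching on it evaluates the indicator.
  q*differing-column : ∀ i (const? : Dec (ConstantColumn L i)) →
    q * Column.differing elements (column i) ≡ maxDiffering * ⟦ ¬? const? ⟧
  q*differing-column i (yes const) = begin
    q * differing     ≡⟨ cong (q *_) (differing-constant (λ (x , p) (y , p′) → const x p y p′)) ⟩
    q * 0             ≡⟨ *-zeroʳ q ⟩
    0                 ≡⟨ *-zeroʳ maxDiffering ⟨
    maxDiffering * 0  ∎
    where
    open ≡-Reasoning
    open Column elements (column i)
  q*differing-column i (no ¬const) =
    trans (Column.q*differing-equidistributed elements (column i) (q*fibre≡size i ¬const))
          (sym (*-identityʳ maxDiffering))

  -- The image column is a map from `L` to `q` letters, so the Cauchy-Schwarz bound applies with the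
  -- same `M`; it is constant whenever the column of `S` is.
  q*differing-image : ∀ (S : Subset q n) (φ : Elem L → Elem S) i (const? : Dec (ConstantColumn S i)) →
    q * Column.differing elements (λ x → lookup (proj₁ (φ x)) i) ≤ maxDiffering * ⟦ ¬? const? ⟧
  q*differing-image S φ i (yes const) = begin
    q * differing     ≡⟨ cong (q *_) (differing-constant (λ x y →
                           const _ (proj₂ (φ x)) _ (proj₂ (φ y)))) ⟩
    q * 0             ≡⟨ *-zeroʳ q ⟩
    0                 ≤⟨ z≤n ⟩
    maxDiffering * 0  ∎
    where
    open ≤-Reasoning
    open Column elements (λ x → lookup (proj₁ (φ x)) i)
  q*differing-image S φ i (no _) =
    ≤-trans (Column.q*differing≤ elements (λ x → lookup (proj₁ (φ x)) i)) (≤-reflexive (sym (*-identityʳ maxDiffering)))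

  metricallyDense : MetricallyDense L
  metricallyDense S (φ , isometry) = *-cancelˡ-≤ maxDiffering {{maxDiffering>0}} (begin
    maxDiffering * R L
      ≡⟨ ∑-nonconstant L maxDiffering ⟨
    ∑ (indices n) (λ i → maxDiffering * ⟦ ¬? (constantColumn? L i) ⟧)
      ≡⟨ ∑-cong (indices n) (λ i → q*differing-column i (constantColumn? L i)) ⟨
    ∑ (indices n) (λ i → q * Column.differing elements (column i))
      ≡⟨ q*∑-dH proj₁ ⟨
    q * ∑ elements (λ x → ∑ elements (λ y → dH (proj₁ x) (proj₁ y)))
      -- Both totals run over pairs from `L`, so the isometry equates them term by term.
      ≡⟨ cong (q *_) (∑-cong elements λ x → ∑-cong elements λ y → isometry x y) ⟨
    q * ∑ elements (λ x → ∑ elements (λ y → dH (proj₁ (to x)) (proj₁ (to y))))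
      ≡⟨ q*∑-dH (proj₁ ∘ to) ⟩
    ∑ (indices n) (λ i → q * Column.differing elements (λ x → lookup (proj₁ (to x)) i))
      ≤⟨ ∑-mono (indices n) (λ i → q*differing-image S to i (constantColumn? S i)) ⟩
    ∑ (indices n) (λ i → maxDiffering * ⟦ ¬? (constantColumn? S i) ⟧)
      ≡⟨ ∑-nonconstant S maxDiffering ⟩
    maxDiffering * R S ∎)
    where
    open ≤-Reasoning
    open Bijection φ using (to)
    q*∑-dH : ∀ (w : Elem L → Word q n) →
      q * ∑ elements (λ x → ∑ elements (λ y → dH (w x) (w y)))
      ≡ ∑ (indices n) (λ i → q * Column.differing elements (λ x → lookup (w x) i))
    q*∑-dH w = trans (cong (q *_) (∑-dH elements w)) (sym (∑-*ˡ (indices n) q _))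

mainTheorem3 : ∀ (n : ℕ) → 2 ≤ n →
    ∀ (q : ℕ) → IsPrimePower q →
    ∀ (F : FieldOn (Fin q)) →
    ∀ (L : Subset q n) → IsLinearSubspace F L → 1 < ∣ L ∣ →
    MetricallyDense L
mainTheorem3 n _ q _ F L isSubspace _ = Subspace.metricallyDense F L isSubspace
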